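{- For every finite connected graph $G$, $c_b(G)\le \gamma_2(G)+1$.
   Context: Bridge-burning Cops and Robbers is played on a finite graph $G$ by a team of cops and a single robber, with full information. First each cop chooses a starting vertex (several cops may share a vertex), then the robber chooses a starting vertex. The game then proceeds in rounds; in each round, first every cop either stays put or moves along an edge of the current graph to an adjacent vertex, and then the robber either stays put or moves along an edge of the current graph. Every edge traversed by the robber is immediately deleted from the graph (cop moves delete nothing). The cops win if at some moment some cop occupies the same vertex as the robber; the robber wins if he avoids this forever. $c_b(G)$ is the minimum number of cops for which the cops have a winning strategy. A distance-2 dominating set of $G$ is a set $S\subseteq V(G)$ such that every vertex of $G$ is at distance at most 2 from some member of $S$; $\gamma_2(G)$ is the minimum size of a distance-2 dominating set. -}

module Defs where

open import Data.Nat using (ℕ; zero; suc; _≤_; _+_)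
open import Data.Fin using (Fin)
open import Data.Fin.Properties using () renaming (_≟_ to _≟F_)
open import Data.Fin.Subset using (Subset; _∈_; ∣_∣)
open import Data.Bool using (Bool; true; false; _∧_; _∨_; not)
open import Data.Product using (Σ; ∃; _×_; _,_)
open import Data.Sum using (_⊎_)
open import Relation.Binary.PropositionalEquality using (_≡_)
open import Relation.Nullary.Decidable using (⌊_⌋)

record Graph (n : ℕ) : Set where
  field
    adj   : Fin n → Fin n → Bool
    sym   : ∀ u v → adj u v ≡ adj v u
    irrfl : ∀ v → adj v v ≡ false
open Graph public

-- Edge sets evolving during the game (subgraphs of G on the same vertices).
EdgeSet : ℕ → Set
EdgeSet n = Fin n → Fin n → Bool

data Reach {n : ℕ} (G : Graph n) : Fin n → Fin n → Set where
  here : ∀ {v} → Reach G v v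
  step : ∀ {u w v} → adj G u w ≡ true → Reach G w v → Reach G u v

Connected : {n : ℕ} → Graph n → Set
Connected {n} G = ∀ (u v : Fin n) → Reach G u v

Dist≤2 : {n : ℕ} → Graph n → Fin n → Fin n → Set
Dist≤2 G u v = (u ≡ v) ⊎ (adj G u v ≡ true)
             ⊎ (∃ λ w → adj G u w ≡ true × adj G w v ≡ true)

IsDist2Dom : {n : ℕ} → Graph n → Subset n → Set
IsDist2Dom {n} G S = ∀ (v : Fin n) → ∃ λ s → s ∈ S × Dist≤2 G s v

IsGamma2 : {n : ℕ} → Graph n → ℕ → Set
IsGamma2 {n} G g =
  (∃ λ (S : Subset n) → IsDist2Dom G S × ∣ S ∣ ≡ g)
  × (∀ (S : Subset n) → IsDist2Dom G S → g ≤ ∣ S ∣)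

deleteEdge : {n : ℕ} → EdgeSet n → Fin n → Fin n → EdgeSet n
deleteEdge E u v x y =
  E x y ∧ not ((⌊ x ≟F u ⌋ ∧ ⌊ y ≟F v ⌋) ∨ (⌊ x ≟F v ⌋ ∧ ⌊ y ≟F u ⌋))

Step : {n : ℕ} → EdgeSet n → Fin n → Fin n → Set
Step E x y = (y ≡ x) ⊎ (E x y ≡ true)

Caught : {n k : ℕ} → (Fin k → Fin n) → Fin n → Set
Caught cops r = ∃ λ i → cops i ≡ r

-- robber move from r to r' in current edge set E: the new edge set
-- (a traversed edge is deleted; staying put deletes nothing).
afterRobber : {n : ℕ} → EdgeSet n → Fin n → Fin n → EdgeSet n
afterRobber E r r' = deleteEdge E r r'

-- CopsWin E cops r : in the position with current edge set E, cops at
-- `cops`, robber at r, cops to move, the cops have a strategy forcing a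
-- capture in finitely many steps (inductive, well-founded game tree).
data CopsWin {n k : ℕ} : EdgeSet n → (Fin k → Fin n) → Fin n → Set where
  caught : ∀ {E cops r} → Caught cops r → CopsWin E cops r
  move   : ∀ {E cops r} (cops' : Fin k → Fin n) →
           (∀ i → Step E (cops i) (cops' i)) →
           (Caught cops' r ⊎
             (∀ (r' : Fin n) → Step E r r' →
                CopsWin (afterRobber E r r') cops' r')) →
           CopsWin E cops r

KCopsWin : {n : ℕ} → Graph n → ℕ → Set
KCopsWin {n} G k =
  ∃ λ (start : Fin k → Fin n) → ∀ (r₀ : Fin n) → CopsWin (adj G) start r₀

-- c_b(G) ≤ m  (c_b is the least k with KCopsWin G k)
CbAtMost : {n : ℕ} → Graph n → ℕ → Set
CbAtMost G m = ∃ λ k → k ≤ m × KCopsWin G k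

{-# OPTIONS --safe #-}

-- One cop sits on each vertex of a minimum distance-2 dominating set; an extra cop chases.
-- While the sitting cops stay, an edge burnt within distance 1 of them costs the robber the game,
-- so the paths of length at most 2 from them survive.  The chaser walks towards the robber and
-- can be shaken off only if the robber crosses a bridge rv away from him.  But if no sitting cop
-- is next to v, then the one dominating v lies beyond the bridge, and he steps next to v as soon
-- as the robber is at r: the bridge is then blocked for good, and what is left of the territory
-- is still dominated by the other cops.  Blocked bridges are removed from the territory.  Every
-- robber move burns an edge of it, and while the robber waits the chaser gets closer.
module Submission where

open import Defs renaming (sym to adj-sym)
open import Data.Nat using (ℕ; zero; suc; _*_; _≤_; _<_; z≤n)
open import Data.Nat.Properties using (≤-refl; ≤-trans; ≤-pred; <-≤-trans)
open import Data.Bool using (Bool; true; false; _∧_; _∨_; not)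
open import Data.Bool.Properties
  using (∧-comm; ∨-comm; ∧-conicalˡ; ∧-conicalʳ) renaming (_≟_ to _≟B_)
open import Data.Empty using (⊥-elim)
open import Data.Fin using (Fin; zero; suc; remQuot; combine)
open import Data.Fin.Properties using (any?; remQuot-combine) renaming (_≟_ to _≟F_)
open import Data.Fin.Subset using (Subset; _∈_; _⊆_; ∣_∣; inside; outside)
open import Data.Fin.Subset.Properties using (p⊆q⇒∣p∣≤∣q∣; p⊂q⇒∣p∣<∣q∣)
open import Data.Product using (∃; _×_; _,_; proj₁; proj₂; uncurry)
open import Data.Sum using (_⊎_; inj₁; inj₂)
open import Data.Nat.Induction using (Acc; acc; <-wellFounded)
open import Data.Vec using ([]; _∷_; tabulate; here; there)
open import Data.Vec.Properties using (lookup∘tabulate; []=⇒lookup; lookup⇒[]=)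
import Data.Vec.Functional as Vector
open import Data.Vec.Functional.Properties using (updateAt-updates; updateAt-minimal)
open import Function using (const; _∘_)
open import Relation.Binary.Construct.Closure.ReflexiveTransitive
  using (Star; ε; _◅_; _◅◅_; gmap; reverse)
open import Relation.Binary.PropositionalEquality
  using (_≡_; _≢_; refl; sym; trans; cong; cong₂; subst)
open import Relation.Nullary using (Dec; yes; no; ¬_)
open import Relation.Nullary.Decidable using (⌊_⌋; _×-dec_; _⊎-dec_; ¬?; map′)

private
  variable
    n g k m : ℕ
    E F : EdgeSet n
    c r s u v x y z : Fin n

-- Attacks and burnt edges.

Edge : EdgeSet n → Fin n → Fin n → Set
Edge E x y = E x y ≡ true

Conn : EdgeSet n → Fin n → Fin n → Set
Conn E = Star (Edge E)

-- The closed neighbourhood of `s`: a cop at `s` who is to move captures a robber there.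
Attacks : EdgeSet n → Fin n → Fin n → Set
Attacks E s x = s ≡ x ⊎ Edge E s x

Near : EdgeSet n → Fin n → Fin n → Set
Near E s x = Attacks E s x ⊎ ∃ λ w → Edge E s w × Edge E w x

delete-⊆ : (E : EdgeSet n) → Edge (deleteEdge E u v) x y → Edge E x y
delete-⊆ {x = x} {y = y} E = ∧-conicalˡ (E x y) _

delete-transfer : (E F : EdgeSet n) → Edge E x y →
                  Edge (deleteEdge F u v) x y → Edge (deleteEdge E u v) x y
delete-transfer {x = x} {y = y} E F e d = cong₂ _∧_ e (∧-conicalʳ (F x y) _ d)

delete-sym : (E : EdgeSet n) → (∀ {x y} → Edge E x y → Edge E y x) →
             Edge (deleteEdge E u v) x y → Edge (deleteEdge E u v) y x
delete-sym {u = u} {v = v} {x = x} {y = y} E E-sym d =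
  cong₂ _∧_ (E-sym (delete-⊆ E d)) (trans (cong not (swap a b a′ b′)) (∧-conicalʳ (E x y) _ d))
  where
  a  = ⌊ x ≟F u ⌋
  b  = ⌊ y ≟F v ⌋
  a′ = ⌊ x ≟F v ⌋
  b′ = ⌊ y ≟F u ⌋
  swap : ∀ a b a′ b′ → b′ ∧ a′ ∨ b ∧ a ≡ a ∧ b ∨ a′ ∧ b′
  swap a b a′ b′ = trans (∨-comm (b′ ∧ a′) (b ∧ a)) (cong₂ _∨_ (∧-comm b a) (∧-comm b′ a′))

delete-removes : (E : EdgeSet n) (u v : Fin n) → ¬ Edge (deleteEdge E u v) u v
delete-removes E u v d with u ≟F u | v ≟F v
... | no u≢u | _      = u≢u refl
... | yes _  | no v≢v = v≢v refl
... | yes _  | yes _  with () ← ∧-conicalʳ (E u v) false d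

delete-cases : (E : EdgeSet n) (u v : Fin n) → Edge E x y →
               Edge (deleteEdge E u v) x y ⊎ (x ≡ u × y ≡ v) ⊎ (x ≡ v × y ≡ u)
delete-cases {x = x} {y = y} E u v e with x ≟F u | y ≟F v | x ≟F v | y ≟F u
... | yes p | yes q | _     | _     = inj₂ (inj₁ (p , q))
... | no _  | _     | yes p | yes q = inj₂ (inj₂ (p , q))
... | yes _ | no _  | yes p | yes q = inj₂ (inj₂ (p , q))
... | yes _ | no _  | yes _ | no _  = inj₁ (cong₂ _∧_ e refl)
... | yes _ | no _  | no _  | _     = inj₁ (cong₂ _∧_ e refl)
... | no _  | _     | yes _ | no _  = inj₁ (cong₂ _∧_ e refl)
... | no _  | _     | no _  | _     = inj₁ (cong₂ _∧_ e refl)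

delete-keeps : (E : EdgeSet n) → x ≢ u → x ≢ v → Edge E x y → Edge (deleteEdge E u v) x y
delete-keeps E x≢u x≢v e with delete-cases E _ _ e
... | inj₁ e′                = e′
... | inj₂ (inj₁ (x≡u , _))  = ⊥-elim (x≢u x≡u)
... | inj₂ (inj₂ (x≡v , _))  = ⊥-elim (x≢v x≡v)

attacks-keep : (E : EdgeSet n) → s ≢ u → s ≢ v → Attacks E s x → Attacks (deleteEdge E u v) s x
attacks-keep E s≢u s≢v (inj₁ s≡x) = inj₁ s≡x
attacks-keep E s≢u s≢v (inj₂ e)   = inj₂ (delete-keeps E s≢u s≢v e)

-- The first edge of the path starts at `s`, the second at a neighbour of `s`; as `s` attacks
-- neither end of the burnt edge, both differ from it.
near-keep : (E : EdgeSet n) → ¬ Attacks E s u → ¬ Attacks E s v →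
            Near E s x → Near (deleteEdge E u v) s x
near-keep E ¬u ¬v (inj₁ a) = inj₁ (attacks-keep E (¬u ∘ inj₁) (¬v ∘ inj₁) a)
near-keep E ¬u ¬v (inj₂ (w , sw , wx)) =
  inj₂ (w , delete-keeps E (¬u ∘ inj₁) (¬v ∘ inj₁) sw
          , delete-keeps E (λ { refl → ¬u (inj₂ sw) }) (λ { refl → ¬v (inj₂ sw) }) wx)

near⇒conn : Near E s x → Conn E s x
near⇒conn (inj₁ (inj₁ refl))     = ε
near⇒conn (inj₁ (inj₂ e))        = e ◅ ε
near⇒conn (inj₂ (_ , e₁ , e₂))   = e₁ ◅ e₂ ◅ ε

conn-⊆ : (∀ {x y} → Edge F x y → Edge E x y) → Conn F x y → Conn E x y
conn-⊆ F⊆E = gmap (λ x → x) F⊆E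

-- Counting edges, as ordered pairs.

arcs : EdgeSet n → Subset (n * n)
arcs {n} E = tabulate (λ e → uncurry E (remQuot {n} n e))

∈-arcs⁻ : (E : EdgeSet n) → ∀ {e} → e ∈ arcs E → uncurry E (remQuot {n} n e) ≡ true
∈-arcs⁻ E {e} e∈ = trans (sym (lookup∘tabulate _ e)) ([]=⇒lookup e∈)

∈-arcs⁺ : (E : EdgeSet n) → ∀ {e} → uncurry E (remQuot {n} n e) ≡ true → e ∈ arcs E
∈-arcs⁺ E {e} h = lookup⇒[]= e _ (trans (lookup∘tabulate _ e) h)

arcs-mono : (E F : EdgeSet n) → (∀ {x y} → Edge F x y → Edge E x y) → arcs F ⊆ arcs E
arcs-mono E F F⊆E e∈ = ∈-arcs⁺ E (F⊆E (∈-arcs⁻ F e∈))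

size : EdgeSet n → ℕ
size E = ∣ arcs E ∣

size-mono : (E F : EdgeSet n) → (∀ {x y} → Edge F x y → Edge E x y) → size F ≤ size E
size-mono E F F⊆E = p⊆q⇒∣p∣≤∣q∣ (arcs-mono E F F⊆E)

size-delete : (E : EdgeSet n) → Edge E u v → size (deleteEdge E u v) < size E
size-delete {u = u} {v = v} E e = p⊂q⇒∣p∣<∣q∣
  ( arcs-mono E E′ (delete-⊆ E)
  , combine u v
  , ∈-arcs⁺ E (trans (cong (uncurry E) (remQuot-combine u v)) e)
  , λ e∈ → delete-removes E u v
             (trans (sym (cong (uncurry E′) (remQuot-combine u v))) (∈-arcs⁻ E′ e∈)) )
  where E′ = deleteEdge E u v

-- Deciding connectedness.

conn-suffix : (E : EdgeSet n) (u v : Fin n) → Conn E x y →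
              Conn (deleteEdge E u v) x y ⊎ Conn (deleteEdge E u v) u y ⊎ Conn (deleteEdge E u v) v y
conn-suffix E u v ε = inj₁ ε
conn-suffix E u v (e ◅ w) with conn-suffix E u v w
... | inj₂ w′ = inj₂ w′
... | inj₁ w′ with delete-cases E u v e
...   | inj₁ e′                 = inj₁ (e′ ◅ w′)
...   | inj₂ (inj₁ (_ , refl))  = inj₂ (inj₂ w′)
...   | inj₂ (inj₂ (_ , refl))  = inj₂ (inj₁ w′)

-- After its last use of its own first edge xz, a walk from x to y continues from x or z in the
-- graph without xz, so the number of edges bounds the recursion.
conn? : (E : EdgeSet n) (x y : Fin n) → Dec (Conn E x y)
conn? E = go E (size E) ≤-refl
  where
  go : (E : EdgeSet n) (m : ℕ) → size E ≤ m → ∀ x y → Dec (Conn E x y)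
  branch : (E : EdgeSet n) (m : ℕ) → size E ≤ m → ∀ x y z →
           Dec (Edge E x z × (Conn (deleteEdge E x z) x y ⊎ Conn (deleteEdge E x z) z y))

  go E m ≤m x y = map′ to from ((x ≟F y) ⊎-dec any? (branch E m ≤m x y))
    where
    to : x ≡ y ⊎ (∃ λ z → Edge E x z × (Conn (deleteEdge E x z) x y ⊎ Conn (deleteEdge E x z) z y)) →
         Conn E x y
    to (inj₁ refl)             = ε
    to (inj₂ (z , _ , inj₁ w)) = conn-⊆ (delete-⊆ E) w
    to (inj₂ (z , e , inj₂ w)) = e ◅ conn-⊆ (delete-⊆ E) w
    from : Conn E x y →
           x ≡ y ⊎ (∃ λ z → Edge E x z × (Conn (deleteEdge E x z) x y ⊎ Conn (deleteEdge E x z) z y))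
    from ε = inj₁ refl
    from (_◅_ {j = z} e w) with conn-suffix E x z w
    ... | inj₁ w′        = inj₂ (z , e , inj₂ w′)
    ... | inj₂ w′        = inj₂ (z , e , w′)

  branch E m ≤m x y z with E x z ≟B true
  ... | no ¬e = no (¬e ∘ proj₁)
  branch E zero ≤m x y z | yes e with () ← ≤-trans (size-delete E e) ≤m
  branch E (suc m) ≤m x y z | yes e =
    yes e ×-dec (go (deleteEdge E x z) m ≤m′ x y ⊎-dec go (deleteEdge E x z) m ≤m′ z y)
    where ≤m′ = ≤-pred (≤-trans (size-delete E e) ≤m)

-- Walks of bounded length.

-- The index only bounds the length, since `stop` has every index; a walk that is cut short keeps
-- its index.
data Walk (E : EdgeSet n) : ℕ → Fin n → Fin n → Set where
  stop : Walk E k x x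
  _∷_  : Edge E x y → Walk E k y z → Walk E (suc k) x z

walk⇒conn : Walk E k x y → Conn E x y
walk⇒conn stop    = ε
walk⇒conn (e ∷ w) = e ◅ walk⇒conn w

conn⇒walk : Conn E x y → ∃ λ k → Walk E k x y
conn⇒walk ε = 0 , stop
conn⇒walk (e ◅ w) with conn⇒walk w
... | k , w′ = suc k , e ∷ w′

-- Cut the walk just before its first use of `rv`: there it stands at `r` or at `v`.
walk-prefix : (E : EdgeSet n) (v : Fin n) → Walk E k x r →
              Walk (deleteEdge E r v) k x r ⊎ Walk (deleteEdge E r v) k x v
walk-prefix E v stop = inj₁ stop
walk-prefix {r = r} E v (e ∷ w) with delete-cases E r v e
... | inj₂ (inj₁ (refl , _)) = inj₁ stop
... | inj₂ (inj₂ (refl , _)) = inj₂ stop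
... | inj₁ e′ with walk-prefix E v w
...   | inj₁ w′ = inj₁ (e′ ∷ w′)
...   | inj₂ w′ = inj₂ (e′ ∷ w′)

attacks? : (E : EdgeSet n) (s x : Fin n) → Dec (Attacks E s x)
attacks? E s x = (s ≟F x) ⊎-dec (E s x ≟B true)

capture : (E : EdgeSet n) (cops : Fin k → Fin n) (i : Fin k) → Attacks E (cops i) r → CopsWin E cops r
capture E cops i (inj₁ p) = caught (i , p)
capture {r = r} E cops i (inj₂ e) =
  move (Vector.updateAt cops i (const r)) legal (inj₁ (i , updateAt-updates i cops))
  where
  legal : ∀ j → Step E (cops j) (Vector.updateAt cops i (const r) j)
  legal j with j ≟F i
  ... | yes refl = inj₂ (trans (cong (E (cops i)) (updateAt-updates i cops)) e)
  ... | no j≢i   = inj₁ (updateAt-minimal j i cops j≢i)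

-- Territories and blocked bridges.

-- E is the current graph and F what remains of it after removing the blocked bridges; c is the
-- chaser, p the other cops, and A marks those of them that have not moved yet.
record Territory (E F : EdgeSet n) (c : Fin n) (p : Fin g → Fin n) (A : Fin g → Bool) : Set where
  field
    F⊆E       : ∀ {x y} → Edge F x y → Edge E x y
    F-sym     : ∀ {x y} → Edge F x y → Edge F y x
    dominated : ∀ {x} → Conn F c x → ∃ λ i → A i ≡ true × Near F (p i) x
    guarded   : ∀ {x y} → Conn F c x → Edge E x y →
                Edge F x y ⊎ ∃ λ i → A i ≡ false × Attacks E (p i) y

Quiet : EdgeSet n → (Fin g → Fin n) → (Fin g → Bool) → Fin n → Set
Quiet E p A r = ∀ i → A i ≡ true → ¬ Attacks E (p i) r

-- The robber moves that shake off the chaser: if he is connected to `r`, then `rv` is a bridge with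
-- him on the side of `r`.
Escape : (F : EdgeSet n) (c : Fin n) (p : Fin g → Fin n) (A : Fin g → Bool) → Fin n → Fin n → Set
Escape F c p A r v =
  Edge F r v × ¬ Conn (deleteEdge F r v) c v × ¬ ∃ λ i → A i ≡ true × Attacks F (p i) v

escape? : (F : EdgeSet n) (c : Fin n) (p : Fin g → Fin n) (A : Fin g → Bool) (r v : Fin n) →
          Dec (Escape F c p A r v)
escape? F c p A r v =
  (F r v ≟B true) ×-dec ¬? (conn? (deleteEdge F r v) c v)
  ×-dec ¬? (any? λ i → (A i ≟B true) ×-dec attacks? F (p i) v)

Redeployment : EdgeSet n → (p : Fin g → Fin n) (A : Fin g → Bool) (p′ : Fin g → Fin n) → Set
Redeployment E p A p′ = ∀ i → p′ i ≡ p i ⊎ (A i ≡ true × Edge E (p i) (p′ i))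

module Post (p : Fin g → Fin n) (A : Fin g → Bool) (i : Fin g) (w : Fin n) where

  post : Fin g → Fin n
  post = Vector.updateAt p i (const w)

  retire : Fin g → Bool
  retire = Vector.updateAt A i (const false)

  post-≡ : w ≡ post i
  post-≡ = sym (updateAt-updates i p)

  post-≢ : ∀ {j} → j ≢ i → post j ≡ p j
  post-≢ {j} j≢i = updateAt-minimal j i p j≢i

  retire-≢ : ∀ {j} → j ≢ i → retire j ≡ A j
  retire-≢ {j} j≢i = updateAt-minimal j i A j≢i

  active⇒≢ : ∀ {j} → retire j ≡ true → j ≢ i
  active⇒≢ a refl with () ← trans (sym a) (updateAt-updates i A)

  post-quiet : Quiet E p A r → Quiet E post retire r
  post-quiet {E = E} quiet j a attacks =
    quiet j (trans (sym (retire-≢ (active⇒≢ a))) a)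
            (subst (λ s → Attacks E s _) (post-≢ (active⇒≢ a)) attacks)

  -- A retired cop never moves again, so several bridges can be blocked within a single cop move.
  post-redeployment : ∀ {q} → A i ≡ true → Edge E (p i) w →
                      Redeployment E post retire q → Redeployment E p A q
  post-redeployment {E = E} Ai iw re j with j ≟F i | re j
  ... | yes refl | inj₁ q       = inj₂ (Ai , subst (Edge E (p i)) (trans post-≡ (sym q)) iw)
  ... | yes refl | inj₂ (a , _) = ⊥-elim (active⇒≢ a refl)
  ... | no j≢i   | inj₁ q       = inj₁ (trans q (post-≢ j≢i))
  ... | no j≢i   | inj₂ (a , e) =
        inj₂ (trans (sym (retire-≢ j≢i)) a , subst (λ s → Edge E s _) (post-≢ j≢i) e)

  -- Cop i is joined beyond the bridge rv to v and to whatever he dominates, so he dominates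
  -- nothing that the chaser still reaches.
  post-territory : Territory E F c p A → Quiet E p A r → Escape F c p A r v →
                   A i ≡ true → Edge F (p i) w → Edge F w v →
                   Territory E (deleteEdge F r v) c post retire
  post-territory {E = E} {F = F} {c = c} {r = r} {v = v} T quiet (rv , ¬cv , ¬near) Ai iw wv = record
    { F⊆E       = F⊆E ∘ delete-⊆ F
    ; F-sym     = delete-sym F F-sym
    ; dominated = dominated′
    ; guarded   = guarded′
    }
    where
    open Territory T
    F′ = deleteEdge F r v

    -- Active cops attack neither end of `rv`: not `r` by `quiet`, not `v` by `¬near`.
    still : ∀ {j x} → A j ≡ true → Near F (p j) x → Near F′ (p j) x
    still {j} Aj = near-keep F
      (λ { (inj₁ q) → quiet j Aj (inj₁ q) ; (inj₂ e) → quiet j Aj (inj₂ (F⊆E e)) })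
      (λ a → ¬near (j , Aj , a))

    dominated′ : ∀ {x} → Conn F′ c x → ∃ λ j → retire j ≡ true × Near F′ (post j) x
    dominated′ cx with dominated (conn-⊆ (delete-⊆ F) cx)
    ... | j , Aj , near with j ≟F i
    ...   | yes refl = ⊥-elim (¬cv (cx ◅◅ reverse (delete-sym F F-sym) (near⇒conn (still Ai near))
                                       ◅◅ near⇒conn (still Ai (inj₂ (w , iw , wv)))))
    ...   | no j≢i   = j , trans (retire-≢ j≢i) Aj
                     , subst (λ s → Near F′ s _) (sym (post-≢ j≢i)) (still Aj near)

    guarded′ : ∀ {x y} → Conn F′ c x → Edge E x y →
               Edge F′ x y ⊎ ∃ λ j → retire j ≡ false × Attacks E (post j) y
    guarded′ cx xy with guarded (conn-⊆ (delete-⊆ F) cx) xy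
    ... | inj₂ (j , Aj , a) = inj₂ (j , trans (retire-≢ j≢i) Aj
                                   , subst (λ s → Attacks E s _) (sym (post-≢ j≢i)) a)
      where
      j≢i : j ≢ i
      j≢i refl with () ← trans (sym Ai) Aj
    ... | inj₁ f with delete-cases F r v f
    ...   | inj₁ f′                   = inj₁ f′
    -- The removed bridge cannot be entered from `v`, which the chaser no longer reaches; entered
    -- from `r`, it leads to `v`, attacked by cop `i` from `w`.
    ...   | inj₂ (inj₂ (refl , refl)) = ⊥-elim (¬cv cx)
    ...   | inj₂ (inj₁ (refl , refl)) =
            inj₂ (i , updateAt-updates i A , subst (λ s → Attacks E s _) post-≡ (inj₂ (F⊆E wv)))

-- Blocking all escapes in one cop move.

record Sealed (E F : EdgeSet n) (c : Fin n)
              (p : Fin g → Fin n) (A : Fin g → Bool) (k : ℕ) (r : Fin n) : Set where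
  field
    F′           : EdgeSet n
    p′           : Fin g → Fin n
    A′           : Fin g → Bool
    F′⊆F         : ∀ {x y} → Edge F′ x y → Edge F x y
    redeployment : Redeployment E p A p′
    territory    : Territory E F′ c p′ A′
    quiet        : Quiet E p′ A′ r
    walk         : Walk F′ k c r
    no-escape    : ∀ v → ¬ Escape F′ c p′ A′ r v

-- Each blocked bridge leaves `F`, so blocking one escape after another ends.
seal : (m : ℕ) (E F : EdgeSet n) {p : Fin g → Fin n} {A : Fin g → Bool} → size F ≤ m →
       Territory E F c p A → Quiet E p A r → Walk F k c r → Sealed E F c p A k r
seal {c = c} {r = r} m E F {p} {A} ≤m T quiet w with any? (escape? F c p A r)
... | no ¬esc = record
  { F′ = F ; p′ = p ; A′ = A ; F′⊆F = λ e → e ; redeployment = λ _ → inj₁ refl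
  ; territory = T ; quiet = quiet ; walk = w ; no-escape = λ v esc → ¬esc (v , esc) }
seal zero E F ≤m T quiet w | yes (v , rv , _)
  with () ← ≤-trans (size-delete F rv) ≤m
seal (suc m) E F {p} {A} ≤m T quiet w | yes (v , esc@(rv , ¬cv , ¬near))
  with Territory.dominated T (walk⇒conn w ◅◅ rv ◅ ε) | walk-prefix F v w
... | _ | inj₂ w′ = ⊥-elim (¬cv (walk⇒conn w′))
... | i , Ai , inj₁ a | _ = ⊥-elim (¬near (i , Ai , a))
-- The middle `x` of the dominating path to `v` becomes the post of cop `i`.
... | i , Ai , inj₂ (x , ix , xv) | inj₁ w′ = record
  { F′ = F′ ; p′ = p′ ; A′ = A′ ; F′⊆F = delete-⊆ F ∘ F′⊆F
  ; redeployment = post-redeployment {E = E} Ai (Territory.F⊆E T ix) redeployment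
  ; territory = territory ; quiet = quiet′ ; walk = walk ; no-escape = no-escape }
  where
  open Post p A i x
  open Sealed (seal m E (deleteEdge F _ v) (≤-pred (≤-trans (size-delete F rv) ≤m))
                 (post-territory T quiet esc Ai ix xv) (post-quiet {E = E} quiet) w′)
    renaming (quiet to quiet′)

-- Playing the rounds.

team : Fin n → (Fin g → Fin n) → Fin (suc g) → Fin n
team = Vector._∷_

threat? : (E : EdgeSet n) (cops : Fin k → Fin n) (r : Fin n) → Dec (∃ λ i → Attacks E (cops i) r)
threat? E cops r = any? λ i → attacks? E (cops i) r

advance : {p : Fin g → Fin n} {A : Fin g → Bool} →
          Territory E F c p A → Edge F c x → Territory E F x p A
advance T e = record
  { F⊆E = F⊆E ; F-sym = F-sym ; dominated = dominated ∘ (e ◅_) ; guarded = guarded ∘ (e ◅_) }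
  where open Territory T

-- Active cops attack neither end of the burnt edge, so `near-keep` applies; retired cops stand at
-- neither end and keep all their edges.
burn : {p : Fin g → Fin n} {A : Fin g → Bool} → Territory E F c p A → Quiet E p A r →
       (∀ i → p i ≢ r) → (∀ i → ¬ Attacks E (p i) v) →
       Territory (deleteEdge E r v) (deleteEdge F r v) c p A
burn {E = E} {F = F} {c = c} {r = r} {v = v} {p = p} {A} T quiet ≢r ¬v = record
  { F⊆E       = λ {x} {y} d → delete-transfer E F (F⊆E (delete-⊆ F d)) d
  ; F-sym     = delete-sym F F-sym
  ; dominated = dominated′
  ; guarded   = guarded′
  }
  where
  open Territory T

  F-attack : ∀ {s x} → Attacks F s x → Attacks E s x
  F-attack (inj₁ q) = inj₁ q
  F-attack (inj₂ e) = inj₂ (F⊆E e)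

  dominated′ : ∀ {x} → Conn (deleteEdge F r v) c x →
               ∃ λ i → A i ≡ true × Near (deleteEdge F r v) (p i) x
  dominated′ cx with dominated (conn-⊆ (delete-⊆ F) cx)
  ... | i , Ai , near = i , Ai , near-keep F (quiet i Ai ∘ F-attack) (¬v i ∘ F-attack) near

  guarded′ : ∀ {x y} → Conn (deleteEdge F r v) c x → Edge (deleteEdge E r v) x y →
             Edge (deleteEdge F r v) x y ⊎ ∃ λ i → A i ≡ false × Attacks (deleteEdge E r v) (p i) y
  guarded′ cx d with guarded (conn-⊆ (delete-⊆ F) cx) (delete-⊆ E d)
  ... | inj₁ f            = inj₁ (delete-transfer F E f d)
  ... | inj₂ (i , Ai , a) = inj₂ (i , Ai , attacks-keep E (≢r i) (¬v i ∘ inj₁) a)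

module _ {n g : ℕ} where

  -- Lexicographic induction: `m` bounds the size of the territory, `k` the length of the chaser's
  -- walk in it.
  Winning : ℕ → ℕ → Set
  Winning m k = ∀ {E F : EdgeSet n} {c r} {p : Fin g → Fin n} {A : Fin g → Bool} →
    size F ≤ m → Territory E F c p A → Walk F k c r → CopsWin E (team c p) r

  round : Winning m k → (∀ {m′} → m′ < m → ∀ k → Winning m′ k) → Winning m (suc k)
  round stays burns {E} {F} {c} {r} {p} {A} ≤m T w with threat? E (team c p) r
  ... | yes (i , a) = capture E (team c p) i a
  round stays burns ≤m T stop | no ¬t = ⊥-elim (¬t (zero , inj₁ refl))
  round stays burns {E} {F} {c} {r} {p} {A} ≤m T (_∷_ {y = c′} e w) | no ¬t = move cops legal outcome
    where
    open Territory using (F⊆E; guarded)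
    -- Escapes are judged with the chaser already at `c′`; no sitting cop attacks `r`, or he would
    -- have captured.
    open Sealed (seal (size F) E F ≤-refl (advance T e) (λ i _ a → ¬t (suc i , a)) w)

    cops : Fin (suc g) → Fin n
    cops = team c′ p′

    legal : ∀ i → Step E (team c p i) (cops i)
    legal zero    = inj₂ (F⊆E T e)
    legal (suc i) with redeployment i
    ... | inj₁ q       = inj₁ q
    ... | inj₂ (_ , e) = inj₂ e

    ≤size : size F′ ≤ size F
    ≤size = size-mono F F′ F′⊆F

    reply : ¬ Caught cops r → ∀ r′ → Step E r r′ → CopsWin (deleteEdge E r r′) cops r′
    reply ¬c r′ st with threat? (deleteEdge E r r′) cops r′
    ... | yes (i , a) = capture _ cops i a
    ... | no ¬t′ = continue st
      where
      -- A cop standing at neither end of the burnt edge still attacks `r′` after the burning.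
      ¬attacked : ∀ i → ¬ Attacks E (p′ i) r′
      ¬attacked i a = ¬t′ (suc i , attacks-keep E (λ q → ¬c (suc i , q)) (λ q → ¬t′ (suc i , inj₁ q)) a)

      T′ : Territory (deleteEdge E r r′) (deleteEdge F′ r r′) c′ p′ A′
      T′ = burn territory quiet (λ i q → ¬c (suc i , q)) ¬attacked

      continue : Step E r r′ → CopsWin (deleteEdge E r r′) cops r′
      -- Waiting deletes at most a loop at `r`, and the bound on the walk has dropped by one.
      continue (inj₁ refl) = stays (≤-trans (size-mono F′ _ (delete-⊆ F′)) (≤-trans ≤size ≤m)) T′ w′
        where
        w′ : Walk (deleteEdge F′ r r) _ c′ r
        w′ with walk-prefix F′ r walk
        ... | inj₁ u = u
        ... | inj₂ u = u
      continue (inj₂ rr′) with guarded territory (walk⇒conn walk) rr′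
      ... | inj₂ (i , _ , a) = ⊥-elim (¬attacked i a)
      ... | inj₁ f with conn? (deleteEdge F′ r r′) c′ r′
      -- The territory has shrunk, so the new walk may have any length.
      ...   | yes cr′ = burns (<-≤-trans (size-delete F′ f) (≤-trans ≤size ≤m)) _ ≤-refl T′
                              (proj₂ (conn⇒walk cr′))
      ...   | no ¬cr′ = ⊥-elim (no-escape r′ (f , ¬cr′ , unattacked))
        where
        unattacked : ¬ ∃ λ i → A′ i ≡ true × Attacks F′ (p′ i) r′
        unattacked (i , _ , inj₁ q)  = ¬attacked i (inj₁ q)
        unattacked (i , _ , inj₂ e′) = ¬attacked i (inj₂ (F⊆E territory e′))

    outcome : Caught cops r ⊎ (∀ r′ → Step E r r′ → CopsWin (deleteEdge E r r′) cops r′)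
    outcome with any? (λ i → cops i ≟F r)
    ... | yes c≡r = inj₁ c≡r
    ... | no ¬c    = inj₂ (reply ¬c)

  winning : Acc _<_ m → ∀ k → Winning m k
  winning _           zero    ≤m T stop = caught (zero , refl)
  winning a@(acc rec) (suc k) = round (winning a k) (λ <m → winning (rec <m))

-- The starting position.

enumerate : (S : Subset n) → ∃ λ (p : Fin ∣ S ∣ → Fin n) → ∀ {s} → s ∈ S → ∃ λ i → p i ≡ s
enumerate [] = (λ ()) , λ ()
enumerate (outside ∷ S) with enumerate S
... | p , onto = suc ∘ p , λ { (there s∈) → let i , q = onto s∈ in i , cong suc q }
enumerate (inside ∷ S) with enumerate S
... | p , onto = (zero Vector.∷ (suc ∘ p))
               , λ { here → zero , refl ; (there s∈) → let i , q = onto s∈ in suc i , cong suc q }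

reach⇒conn : {G : Graph n} → Reach G x y → Conn (adj G) x y
reach⇒conn Reach.here       = ε
reach⇒conn (Reach.step e w) = e ◅ reach⇒conn w

dist≤2⇒near : {G : Graph n} → Dist≤2 G x y → Near (adj G) x y
dist≤2⇒near (inj₁ q)        = inj₁ (inj₁ q)
dist≤2⇒near (inj₂ (inj₁ e)) = inj₁ (inj₂ e)
dist≤2⇒near (inj₂ (inj₂ w)) = inj₂ w

theorem2p4 : ∀ {n : ℕ} (G : Graph n) → Connected G →
    ∀ (g : ℕ) → IsGamma2 G g → CbAtMost G (suc g)
-- The empty graph has no vertex for a cop, and none for the robber.
theorem2p4 {zero} G conn g γ = 0 , z≤n , (λ ()) , λ ()
theorem2p4 {suc n} G conn g ((S , dom , refl) , _) = suc g , ≤-refl , team zero p , λ r →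
  winning (<-wellFounded _) _ ≤-refl T (proj₂ (conn⇒walk (reach⇒conn (conn zero r))))
  where
  p    = proj₁ (enumerate S)
  onto = proj₂ (enumerate S)

  dominated : ∀ x → ∃ λ i → true ≡ true × Near (adj G) (p i) x
  dominated x with dom x
  ... | s , s∈S , d with onto s∈S
  ...   | i , refl = i , refl , dist≤2⇒near {G = G} d

  -- At first nothing is blocked and every sitting cop is active.
  T : Territory (adj G) (adj G) zero p (const true)
  T = record
    { F⊆E       = λ e → e
    ; F-sym     = λ {x} {y} e → trans (adj-sym G y x) e
    ; dominated = λ {x} _ → dominated x
    ; guarded   = λ _ e → inj₁ e
    }
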